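{- Let $r \ge 1$ and let $H$ be an $r$-graph that maximises $P_2(\cdot)$ among $r$-graphs with the same number of edges (that is, $P_2(H) \ge P_2(H')$ for every $r$-graph $H'$ with $|H'| = |H|$). Then either $H$ is isomorphic to a subgraph of the clique $[r+1]^{(r)}$, or there is a set of $r-1$ vertices which is contained in every edge of $H$.
   Context: $\mathbb{N} = \{1,2,3,\dots\}$, $[t] = \{1,\dots,t\}$, and for a set $X$, $X^{(r)}$ denotes the family of all $r$-element subsets of $X$. An $r$-graph is a finite family $H \subseteq \mathbb{N}^{(r)}$; its members are its edges, and $|H|$ is the number of edges. Isomorphism is via relabelling of vertices (isolated vertices are ignored). The sum of degrees squared of $H$ is $P_2(H) := \sum_{x} d(x)^2$, where $d(x)$ is the number of edges of $H$ containing the vertex $x$. -}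

module Defs where

open import Data.Nat using (ℕ; _≤_; _<_; _≟_; _^_)
open import Data.List using (List; length; map; filter; concat; deduplicate; sum)
open import Data.List.Membership.Propositional using (_∈_)
open import Data.List.Membership.DecPropositional _≟_ using (_∈?_)
open import Data.List.Relation.Binary.BagAndSetEquality using (_∼[_]_; set)
open import Data.List.Relation.Unary.All using (All)
open import Data.List.Relation.Unary.AllPairs using (AllPairs)
open import Data.List.Relation.Unary.Unique.Propositional using (Unique)
open import Data.Product using (_×_; ∃-syntax)
open import Level using (0ℓ)
open import Relation.Binary.PropositionalEquality using (_≡_)
open import Relation.Unary using (Pred)

-- A finite set of naturals is represented by its strictly increasing
-- enumeration, so propositional equality of representatives is equality of
-- sets.

VertexSet : Set
VertexSet = List ℕ

ℕ₊ : Pred ℕ 0ℓ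
ℕ₊ x = 1 ≤ x

[_] : ℕ → Pred ℕ 0ℓ
[ t ] x = 1 ≤ x × x ≤ t

infix 8 _⁽_⁾

_⁽_⁾ : Pred ℕ 0ℓ → ℕ → Pred VertexSet 0ℓ
(X ⁽ r ⁾) e = AllPairs _<_ e × All X e × length e ≡ r

-- The order in which the edges are listed is irrelevant to every notion below.
record RGraph (r : ℕ) : Set where
  field
    edges  : List VertexSet
    unique : Unique edges
    rsets  : All (ℕ₊ ⁽ r ⁾) edges

open RGraph public

module _ {r : ℕ} where

  ∣_∣ : RGraph r → ℕ
  ∣ H ∣ = length (edges H)

  -- The non-isolated vertices, without repetition.
  vertices : RGraph r → List ℕ
  vertices H = deduplicate _≟_ (concat (edges H))

  degree : RGraph r → ℕ → ℕ
  degree H x = length (filter (x ∈?_) (edges H))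

  -- Vertices outside `vertices H` have degree 0 and contribute nothing.
  P₂ : RGraph r → ℕ
  P₂ H = sum (map (λ x → degree H x ^ 2) (vertices H))

  MaximisesP₂ : RGraph r → Set
  MaximisesP₂ H = ∀ (H′ : RGraph r) → ∣ H′ ∣ ≡ ∣ H ∣ → P₂ H′ ≤ P₂ H

  infix 4 _≅_ _⊆ᴱ_

  _⊆ᴱ_ : RGraph r → Pred VertexSet 0ℓ → Set
  H ⊆ᴱ F = All F (edges H)

  -- Only the values of `relabel` on the non-isolated vertices of H matter.
  -- A relabelled edge need not be listed in increasing order, so it is compared
  -- with edges of K as a set.  Surjectivity onto the non-isolated vertices of K
  -- follows from `onto`.
  record _≅_ (H K : RGraph r) : Set where
    field
      relabel   : ℕ → ℕ
      injective : ∀ {x y} → x ∈ vertices H → y ∈ vertices H →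
                  relabel x ≡ relabel y → x ≡ y
      into      : ∀ {e} → e ∈ edges H →
                  ∃[ e′ ] e′ ∈ edges K × map relabel e ∼[ set ] e′
      onto      : ∀ {e′} → e′ ∈ edges K →
                  ∃[ e ] e ∈ edges H × map relabel e ∼[ set ] e′

{-# OPTIONS --safe #-}
-- Double counting gives P₂(H) = ∑ |e ∩ f| over ordered pairs of
-- edges.  Distinct r-sets meet in at most r - 1 vertices, and a star (all edges
-- through a common (r-1)-set) attains this for every pair, so in a maximiser any
-- two distinct edges meet in exactly r - 1 vertices.
--
-- Let e ≠ f be edges of such an H, b ∈ f ∖ e and U = e ∪ f = e ∪ {b}, an
-- (r+1)-set.  If an edge g leaves U, at y say, then g ∖ e = {y}, so b ∉ g; as
-- f ∖ g has only one element, g contains e ∩ f.  An edge h missing some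
-- s ∈ e ∩ f therefore lies in U, and then s and y are distinct elements of
-- g ∖ h, a contradiction.  So either all edges lie in U or all contain e ∩ f.
module Submission where

open import Defs
open import Data.Bool using (true; false; if_then_else_)
open import Data.Fin using (toℕ)
open import Data.Fin.Properties using (toℕ<n; toℕ-injective)
open import Data.List using (List; []; _∷_; _∷ʳ_; length; map; filter; applyUpTo; upTo)
open import Data.List.Membership.DecPropositional using (_∈?_)
open import Data.List.Membership.Propositional using (_∈_; _∉_; find)
open import Data.List.Membership.Propositional.Properties using (∈-filter⁺; ∈-filter⁻; ∈-map⁺; ∈-map⁻; ∈-applyUpTo⁺; ∈-applyUpTo⁻; ∈-concat⁺′; ∈-concat⁻′; ∈-deduplicate⁺; ∈-deduplicate⁻)
open import Data.List.Membership.Propositional.Properties.WithK using (unique∧set⇒bag)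
open import Data.List.Membership.Setoid.Properties using (index-injective)
open import Data.List.Properties using (≡-dec; length-map; length-filter; length-++; length-applyUpTo; filter-complete; filter-all; ∷ʳ-injectiveʳ)
open import Data.List.Relation.Binary.BagAndSetEquality using (_∼[_]_; set; ∼bag⇒↭)
open import Data.List.Relation.Binary.Permutation.Propositional using (_↭_; ↭-sym; ↭⇒↭ₛ)
open import Data.List.Relation.Binary.Permutation.Propositional.Properties using (↭-length) renaming (map⁺ to ↭-map⁺)
open import Data.List.Relation.Binary.Pointwise using (Pointwise-≡⇒≡)
open import Data.List.Relation.Binary.Subset.Propositional using (_⊆_)
open import Data.List.Relation.Binary.Subset.Propositional.Properties using (xs⊆xs++ys)
open import Data.List.Relation.Unary.All as All using (All; []; _∷_)
import Data.List.Relation.Unary.All.Properties as All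
open import Data.List.Relation.Unary.AllPairs as AllPairs using (AllPairs; []; _∷_)
import Data.List.Relation.Unary.AllPairs.Properties as AllPairs
open import Data.List.Relation.Unary.Any using (here; there; index)
open import Data.List.Relation.Unary.Linked.Properties using (AllPairs⇒Linked)
open import Data.List.Relation.Unary.Sorted.TotalOrder.Properties using (↗↭↗⇒≋)
open import Data.List.Relation.Unary.Unique.DecPropositional.Properties using (deduplicate-!)
open import Data.List.Relation.Unary.Unique.Propositional using (Unique)
import Data.List.Relation.Unary.Unique.Propositional.Properties as Unique
open import Data.Nat using (ℕ; suc; _≤_; _<_; _≟_; _+_; _∸_; _*_; _^_; z≤n; s≤s; s≤s⁻¹; s<s)
open import Data.Nat.ListAction using (sum)
open import Data.Nat.ListAction.Properties using (sum-↭)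
open import Data.Nat.Properties
open import Algebra.Properties.CommutativeSemigroup +-commutativeSemigroup using (interchange)
open import Data.Product using (_×_; _,_; ∃-syntax; proj₁; proj₂)
open import Data.Sum using (_⊎_; inj₁; inj₂)
open import Function using (_∘_; mk⇔; Equivalence)
open import Relation.Binary.Definitions using (DecidableEquality)
open import Relation.Binary.PropositionalEquality using (_≡_; _≢_; refl; sym; trans; cong; cong₂; subst; setoid; module ≡-Reasoning)
open import Relation.Nullary using (Dec; yes; no; does; contradiction)
open import Relation.Unary using (Decidable)

private variable
  A B : Set
  k n r : ℕ
  x y : A
  xs ys : List A
  e f g h : VertexSet

-- Finite sums

∑ : List A → (A → ℕ) → ℕ
∑ xs f = sum (map f xs)

module _ {f g : A → ℕ} where

  ∑-cong : ∀ xs → (∀ {x} → x ∈ xs → f x ≡ g x) → ∑ xs f ≡ ∑ xs g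
  ∑-cong []       eq = refl
  ∑-cong (x ∷ xs) eq = cong₂ _+_ (eq (here refl)) (∑-cong xs (eq ∘ there))

  ∑-mono-≤ : ∀ xs → (∀ {x} → x ∈ xs → f x ≤ g x) → ∑ xs f ≤ ∑ xs g
  ∑-mono-≤ []       le = z≤n
  ∑-mono-≤ (x ∷ xs) le = +-mono-≤ (le (here refl)) (∑-mono-≤ xs (le ∘ there))

  -- The equality case of `∑-mono-≤`: a strict gap at one term could not be made up elsewhere.
  -- Cancelling the tail comparison settles the head, and cancelling the head comparison passes the
  -- reversed inequality on to the tail.
  ∑-mono-≤-tight : ∀ xs → (∀ {x} → x ∈ xs → f x ≤ g x) → ∑ xs g ≤ ∑ xs f →
                   ∀ {x} → x ∈ xs → g x ≤ f x
  ∑-mono-≤-tight (y ∷ ys) le ge (here refl) = +-cancelʳ-≤ (∑ ys g) (g y) (f y)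
    (≤-trans ge (+-monoʳ-≤ (f y) (∑-mono-≤ ys (le ∘ there))))
  ∑-mono-≤-tight (y ∷ ys) le ge (there x∈ys) = ∑-mono-≤-tight ys (le ∘ there)
    (+-cancelˡ-≤ (g y) _ _ (≤-trans ge (+-monoˡ-≤ (∑ ys f) (le (here refl))))) x∈ys

∑-const : ∀ (xs : List A) c → ∑ xs (λ _ → c) ≡ length xs * c
∑-const []       c = refl
∑-const (x ∷ xs) c = cong (c +_) (∑-const xs c)

∑-+ : ∀ (xs : List A) (f g : A → ℕ) → ∑ xs (λ x → f x + g x) ≡ ∑ xs f + ∑ xs g
∑-+ []       f g = refl
∑-+ (x ∷ xs) f g = begin
  f x + g x + ∑ xs (λ x → f x + g x) ≡⟨ cong (f x + g x +_) (∑-+ xs f g) ⟩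
  f x + g x + (∑ xs f + ∑ xs g)      ≡⟨ interchange (f x) (g x) _ _ ⟩
  f x + ∑ xs f + (g x + ∑ xs g)      ∎
  where open ≡-Reasoning

∑-*ʳ : ∀ (xs : List A) (f : A → ℕ) c → ∑ xs f * c ≡ ∑ xs (λ x → f x * c)
∑-*ʳ []       f c = refl
∑-*ʳ (x ∷ xs) f c = trans (*-distribʳ-+ c (f x) (∑ xs f)) (cong (f x * c +_) (∑-*ʳ xs f c))

∑-comm : ∀ (xs : List A) (ys : List B) (f : A → B → ℕ) →
         ∑ xs (λ x → ∑ ys (f x)) ≡ ∑ ys (λ y → ∑ xs (λ x → f x y))
∑-comm []       ys f = sym (trans (∑-const ys 0) (*-zeroʳ (length ys)))
∑-comm (x ∷ xs) ys f = begin
  ∑ ys (f x) + ∑ xs (λ x → ∑ ys (f x))              ≡⟨ cong (∑ ys (f x) +_) (∑-comm xs ys f) ⟩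
  ∑ ys (f x) + ∑ ys (λ y → ∑ xs (λ x → f x y))      ≡⟨ ∑-+ ys (f x) _ ⟨
  ∑ ys (λ y → f x y + ∑ xs (λ x → f x y))           ∎
  where open ≡-Reasoning

-- The Iverson bracket, which turns counts into sums whose order can be exchanged.
⟦_⟧ : Dec A → ℕ
⟦ d ⟧ = if does d then 1 else 0

module _ {P : A → Set} (P? : Decidable P) where

  length-filter≡∑ : ∀ xs → length (filter P? xs) ≡ ∑ xs (⟦_⟧ ∘ P?)
  length-filter≡∑ []       = refl
  length-filter≡∑ (x ∷ xs) with does (P? x)
  ... | true  = cong suc (length-filter≡∑ xs)
  ... | false = length-filter≡∑ xs

  ∑-filter : ∀ xs (f : A → ℕ) → ∑ (filter P? xs) f ≡ ∑ xs (λ x → ⟦ P? x ⟧ * f x)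
  ∑-filter []       f = refl
  ∑-filter (x ∷ xs) f with does (P? x)
  ... | true  = cong₂ _+_ (sym (*-identityˡ (f x))) (∑-filter xs f)
  ... | false = ∑-filter xs f

-- Lists as finite sets

Unique⇒↭ : Unique xs → Unique ys → xs ∼[ set ] ys → xs ↭ ys
Unique⇒↭ xs! ys! xs∼ys = ∼bag⇒↭ (unique∧set⇒bag xs! ys! xs∼ys)

module _ (_≟ᴬ_ : DecidableEquality A) {xs ys : List A} where

  -- Both lists are free of repetitions and have the same members. This yields the comparison of
  -- cardinalities and the restriction of sums that follow.
  filter-∈-↭ : Unique xs → Unique ys → xs ⊆ ys → filter (λ y → _∈?_ _≟ᴬ_ y xs) ys ↭ xs
  filter-∈-↭ xs! ys! xs⊆ys = Unique⇒↭ (Unique.filter⁺ ∈xs? ys!) xs!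
    (mk⇔ (proj₂ ∘ ∈-filter⁻ ∈xs? {xs = ys}) (λ x∈xs → ∈-filter⁺ ∈xs? (xs⊆ys x∈xs) x∈xs))
    where
    ∈xs? : Decidable (_∈ xs)
    ∈xs? y = _∈?_ _≟ᴬ_ y xs

  Unique-⊆⇒length≤ : Unique xs → Unique ys → xs ⊆ ys → length xs ≤ length ys
  Unique-⊆⇒length≤ xs! ys! xs⊆ys =
    subst (_≤ length ys) (↭-length (filter-∈-↭ xs! ys! xs⊆ys)) (length-filter _ ys)

  ∑-restrict : Unique xs → Unique ys → xs ⊆ ys → (f : A → ℕ) →
               ∑ ys (λ y → ⟦ _∈?_ _≟ᴬ_ y xs ⟧ * f y) ≡ ∑ xs f
  ∑-restrict xs! ys! xs⊆ys f = trans (sym (∑-filter _ ys f))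
    (sum-↭ (↭-map⁺ f (filter-∈-↭ xs! ys! xs⊆ys)))

Unique-map⁺ : ∀ (f : A → B) {xs} → (∀ {x y} → x ∈ xs → y ∈ xs → f x ≡ f y → x ≡ y) →
              Unique xs → Unique (map f xs)
Unique-map⁺ f inj []            = []
Unique-map⁺ f inj (x∉xs ∷ xs!) =
  All.map⁺ (All.tabulate λ y∈xs → All.lookup x∉xs y∈xs ∘ inj (here refl) (there y∈xs))
  ∷ Unique-map⁺ f (λ x∈xs y∈xs → inj (there x∈xs) (there y∈xs)) xs!

∑-δ : (_≟ᴬ_ : DecidableEquality A) → Unique xs → x ∈ xs → ∑ xs (λ y → ⟦ x ≟ᴬ y ⟧) ≡ 1
∑-δ {xs = xs} {x = x} _≟ᴬ_ xs! x∈xs = trans (sym (length-filter≡∑ (x ≟ᴬ_) xs))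
  (↭-length (Unique⇒↭ {ys = x ∷ []} (Unique.filter⁺ (x ≟ᴬ_) xs!) ([] ∷ [])
    (mk⇔ (here ∘ sym ∘ proj₂ ∘ ∈-filter⁻ (x ≟ᴬ_) {xs = xs}) λ { (here refl) → ∈-filter⁺ (x ≟ᴬ_) x∈xs refl })))

-- Vertex sets

_≟ᵉ_ : DecidableEquality VertexSet
_≟ᵉ_ = ≡-dec _≟_

infixl 7 _∩_

_∩_ : VertexSet → VertexSet → VertexSet
e ∩ f = filter (λ x → _∈?_ _≟_ x f) e

∈-∩⁺ : x ∈ e → x ∈ f → x ∈ e ∩ f
∈-∩⁺ = ∈-filter⁺ (λ x → _∈?_ _≟_ x _)

∈-∩⁻ : x ∈ e ∩ f → x ∈ e × x ∈ f
∈-∩⁻ {e = e} = ∈-filter⁻ (λ x → _∈?_ _≟_ x _) {xs = e}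

ascending⇒Unique : AllPairs _<_ e → Unique e
ascending⇒Unique = AllPairs.map <⇒≢

ascending-↭⇒≡ : AllPairs _<_ e → AllPairs _<_ f → e ↭ f → e ≡ f
ascending-↭⇒≡ e↗ f↗ e↭f = Pointwise-≡⇒≡ (↗↭↗⇒≋ ≤-totalOrder (sorted e↗) (sorted f↗) (↭⇒↭ₛ e↭f))
  where sorted = λ {e} (e↗ : AllPairs _<_ e) → AllPairs⇒Linked (AllPairs.map <⇒≤ e↗)

∩-idem : ∀ e → e ∩ e ≡ e
∩-idem e = filter-all _ (All.tabulate λ x∈e → x∈e)

Unique-rset : (ℕ₊ ⁽ r ⁾) e → Unique e
Unique-rset (e↗ , _) = ascending⇒Unique e↗

-- If `e` were contained in `f`, then `f ∩ e` would have the full length `r` of `f`. Filtering would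
-- thus have removed nothing, and `f` would be a permutation of `e`, hence equal to it since both
-- are increasing.
difference-inhabited : (ℕ₊ ⁽ r ⁾) e → (ℕ₊ ⁽ r ⁾) f → e ≢ f → ∃[ x ] x ∈ e × x ∉ f
difference-inhabited {e = e} {f = f} re@(e↗ , _ , ∣e∣) rf@(f↗ , _ , ∣f∣) e≢f
  with All.all? (λ x → _∈?_ _≟_ x f) e
... | no  e⊈f = find (All.¬All⇒Any¬ (λ x → _∈?_ _≟_ x f) e e⊈f)
... | yes e⊆f = contradiction (ascending-↭⇒≡ e↗ f↗ (↭-sym (subst (_↭ e) f∩e≡f f∩e↭e))) e≢f
  where
  f∩e↭e : f ∩ e ↭ e
  f∩e↭e = filter-∈-↭ _≟_ (Unique-rset re) (Unique-rset rf) (All.lookup e⊆f)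

  f∩e≡f : f ∩ e ≡ f
  f∩e≡f = filter-complete _ (trans (↭-length f∩e↭e) (trans ∣e∣ (sym ∣f∣)))

-- An element of `e` outside `f`, put in front of `e ∩ f`, still gives distinct elements of `e`.
∣∩∣≤ : (ℕ₊ ⁽ suc k ⁾) e → (ℕ₊ ⁽ suc k ⁾) f → e ≢ f → length (e ∩ f) ≤ k
∣∩∣≤ {e = e} re@(e↗ , _ , ∣e∣) rf e≢f with x , x∈e , x∉f ← difference-inhabited re rf e≢f =
  s≤s⁻¹ (subst (suc (length (e ∩ _)) ≤_) ∣e∣ (Unique-⊆⇒length≤ _≟_
    (All.tabulate (λ {y} y∈ x≡y → x∉f (subst (_∈ _) (sym x≡y) (proj₂ (∈-∩⁻ {e = e} y∈))))
      ∷ Unique.filter⁺ _ (Unique-rset re))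
    (Unique-rset re)
    λ { (here refl) → x∈e ; (there y∈) → proj₁ (∈-∩⁻ {e = e} y∈) }))

-- Were `x` and `y` different, they would form together with `e ∩ f` at least `k + 2` distinct
-- elements of `e`.
difference-unique : (ℕ₊ ⁽ suc k ⁾) e → k ≤ length (e ∩ f) →
                    x ∈ e → x ∉ f → y ∈ e → y ∉ f → x ≡ y
difference-unique {k} {e} {f} {x} {y} re@(_ , _ , ∣e∣) k≤ x∈e x∉f y∈e y∉f with x ≟ y
... | yes x≡y = x≡y
... | no  x≢y = contradiction (≤-trans (s≤s (s≤s k≤)) (subst (2 + length (e ∩ f) ≤_) ∣e∣
    (Unique-⊆⇒length≤ _≟_
      ((x≢y ∷ outside x∉f) ∷ outside y∉f ∷ Unique.filter⁺ _ (Unique-rset re))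
      (Unique-rset re)
      λ { (here refl) → x∈e ; (there (here refl)) → y∈e
        ; (there (there z∈)) → proj₁ (∈-∩⁻ {e = e} z∈) })))
    1+n≰n
  where
  outside : ∀ {z} → z ∉ f → All (z ≢_) (e ∩ f)
  outside z∉f = All.tabulate λ w∈ z≡w → z∉f (subst (_∈ f) (sym z≡w) (proj₂ (∈-∩⁻ {e = e} w∈)))

-- Initial segments of the positive integers

interval : ℕ → VertexSet
interval = applyUpTo suc

interval-ascending : ∀ n → AllPairs _<_ (interval n)
interval-ascending n = AllPairs.applyUpTo⁺₁ suc n λ i<j _ → s<s i<j

∈-interval⁺ : [ n ] x → x ∈ interval n
∈-interval⁺ {x = suc i} (_ , i<n) = ∈-applyUpTo⁺ suc i<n

∈-interval⁻ : x ∈ interval n → [ n ] x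
∈-interval⁻ x∈ with i , i<n , refl ← ∈-applyUpTo⁻ suc x∈ = s≤s z≤n , i<n

-- The sum of the degrees squared

module _ (H : RGraph r) where

  rset : e ∈ edges H → (ℕ₊ ⁽ r ⁾) e
  rset = All.lookup (rsets H)

  ⊆vertices : e ∈ edges H → e ⊆ vertices H
  ⊆vertices e∈H x∈e = ∈-deduplicate⁺ _≟_ (∈-concat⁺′ x∈e e∈H)

  -- The square is opened one factor at a time: the indicator of `x ∈ e` from the first factor cuts
  -- `V` down to `e`, and only then does the second factor become a sum over `f`.
  P₂≡∑∣∩∣ : P₂ H ≡ ∑ (edges H) λ e → ∑ (edges H) λ f → length (e ∩ f)
  P₂≡∑∣∩∣ = begin
    ∑ V (λ x → d x ^ 2)                          ≡⟨ ∑-cong V (λ {x} _ → d²≡ x) ⟩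
    ∑ V (λ x → ∑ E λ e → ⟦ x ∈ᵉ? e ⟧ * d x)      ≡⟨ ∑-comm V E _ ⟩
    ∑ E (λ e → ∑ V λ x → ⟦ x ∈ᵉ? e ⟧ * d x)      ≡⟨ ∑-cong E restrict ⟩
    ∑ E (λ e → ∑ e d)                            ≡⟨ ∑-cong E (λ {e} _ → ∑-cong e λ {x} _ → d≡ x) ⟩
    ∑ E (λ e → ∑ e λ x → ∑ E λ f → ⟦ x ∈ᵉ? f ⟧)  ≡⟨ ∑-cong E (λ {e} _ → ∑-comm e E _) ⟩
    ∑ E (λ e → ∑ E λ f → ∑ e λ x → ⟦ x ∈ᵉ? f ⟧)
      ≡⟨ ∑-cong E (λ {e} _ → ∑-cong E λ {f} _ → length-filter≡∑ (_∈ᵉ? f) e) ⟨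
    ∑ E (λ e → ∑ E λ f → length (e ∩ f))         ∎
    where
    open ≡-Reasoning
    V = vertices H
    E = edges H
    d = degree H
    _∈ᵉ?_ = _∈?_ _≟_

    d≡ : ∀ x → d x ≡ ∑ E λ e → ⟦ x ∈ᵉ? e ⟧
    d≡ x = length-filter≡∑ (x ∈ᵉ?_) E

    d²≡ : ∀ x → d x ^ 2 ≡ ∑ E λ e → ⟦ x ∈ᵉ? e ⟧ * d x
    -- `d x ^ 2` computes to `d x * (d x * 1)`.
    d²≡ x = trans (cong (d x *_) (*-identityʳ (d x)))
      (trans (cong (_* d x) (d≡ x)) (∑-*ʳ E _ (d x)))

    restrict : e ∈ E → ∑ V (λ x → ⟦ x ∈ᵉ? e ⟧ * d x) ≡ ∑ e d
    restrict e∈H = ∑-restrict _≟_ (Unique-rset (rset e∈H)) (deduplicate-! _≟_ _) (⊆vertices e∈H) d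

-- The largest possible size of `e ∩ f` for sets of size `k + 1`; the bracket accounts for the
-- diagonal pairs.
bound : ℕ → VertexSet → VertexSet → ℕ
bound k e f = k + ⟦ e ≟ᵉ f ⟧

∣∩∣≤bound : (ℕ₊ ⁽ suc k ⁾) e → (ℕ₊ ⁽ suc k ⁾) f → length (e ∩ f) ≤ bound k e f
∣∩∣≤bound {k} {e} {f} re@(_ , _ , ∣e∣) rf with e ≟ᵉ f
... | yes refl = ≤-reflexive (trans (cong length (∩-idem e)) (trans ∣e∣ (+-comm 1 k)))
... | no  e≢f  = ≤-trans (∣∩∣≤ re rf e≢f) (m≤m+n k 0)

-- Each row meets the diagonal exactly once, as edges are listed without repetition. The total
-- therefore depends only on `k` and the number of edges, so that it is the same for `H` and for a
-- star of equal size.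
∑-bound : ∀ k (H : RGraph r) →
          ∑ (edges H) (λ e → ∑ (edges H) (bound k e)) ≡ ∣ H ∣ * (∣ H ∣ * k + 1)
∑-bound k H = trans (∑-cong (edges H) row) (∑-const (edges H) _)
  where
  row : e ∈ edges H → ∑ (edges H) (bound k e) ≡ ∣ H ∣ * k + 1
  row e∈H = trans (∑-+ (edges H) _ _)
    (cong₂ _+_ (∑-const (edges H) k) (∑-δ _≟ᵉ_ (unique H) e∈H))

-- Stars, which attain the bound

petal : ℕ → ℕ → VertexSet
petal k j = interval k ∷ʳ suc (k + j)

petal-injective : ∀ {i j} → petal k i ≡ petal k j → i ≡ j
petal-injective {k} eq =
  +-cancelˡ-≡ k _ _ (suc-injective (∷ʳ-injectiveʳ (interval k) (interval k) eq))

-- The last vertex `suc (k + j)` exceeds every element of `interval k`, already for `j = 0`, so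
-- appending it keeps the list increasing.
petal-rset : ∀ k j → (ℕ₊ ⁽ suc k ⁾) (petal k j)
petal-rset k j =
    AllPairs.++⁺ (interval-ascending k) ([] ∷ [])
      (All.tabulate λ x∈ → s≤s (≤-trans (proj₂ (∈-interval⁻ x∈)) (m≤m+n k j)) ∷ [])
  , All.++⁺ (All.tabulate (proj₁ ∘ ∈-interval⁻)) (s≤s z≤n ∷ [])
  , trans (length-++ (interval k)) (trans (cong (_+ 1) (length-applyUpTo suc k)) (+-comm k 1))

star : ∀ k → ℕ → RGraph (suc k)
star k m = record
  { edges  = map (petal k) (upTo m)
  ; unique = Unique.map⁺ petal-injective (Unique.upTo⁺ m)
  ; rsets  = All.map⁺ (All.tabulate λ {j} _ → petal-rset k j)
  }

-- Distinct petals share the core `interval k`; equal ones meet in a whole petal, of size `k + 1`.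
bound≤∣petal∩petal∣ : ∀ k i j → bound k (petal k i) (petal k j) ≤ length (petal k i ∩ petal k j)
bound≤∣petal∩petal∣ k i j with petal k i ≟ᵉ petal k j
... | yes eq = ≤-reflexive (sym (trans (cong (λ f → length (petal k i ∩ f)) (sym eq))
                 (trans (cong length (∩-idem (petal k i))) (trans (proj₂ (proj₂ (petal-rset k i))) (+-comm 1 k)))))
... | no  _  = subst (_≤ length (petal k i ∩ petal k j)) (trans (length-applyUpTo suc k) (sym (+-identityʳ k)))
    (Unique-⊆⇒length≤ _≟_ (ascending⇒Unique (interval-ascending k))
      (Unique.filter⁺ _ (Unique-rset (petal-rset k i)))
      λ x∈ → ∈-∩⁺ (xs⊆xs++ys _ _ x∈) (xs⊆xs++ys _ _ x∈))

∣star∣ : ∀ k m → ∣ star k m ∣ ≡ m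
∣star∣ k m = trans (length-map (petal k) (upTo m)) (length-applyUpTo _ m)

P₂-star : ∀ k m → m * (m * k + 1) ≤ P₂ (star k m)
P₂-star k m = begin
  m * (m * k + 1)                            ≡⟨ cong (λ l → l * (l * k + 1)) (∣star∣ k m) ⟨
  ∣ star k m ∣ * (∣ star k m ∣ * k + 1)      ≡⟨ ∑-bound k (star k m) ⟨
  ∑ E (λ e → ∑ E (bound k e))                ≤⟨ ∑-mono-≤ E (λ e∈ → ∑-mono-≤ E (λ f∈ → pair e∈ f∈)) ⟩
  ∑ E (λ e → ∑ E λ f → length (e ∩ f))       ≡⟨ P₂≡∑∣∩∣ (star k m) ⟨
  P₂ (star k m)                              ∎
  where
  open ≤-Reasoning
  E = edges (star k m)

  pair : e ∈ E → f ∈ E → bound k e f ≤ length (e ∩ f)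
  pair e∈ f∈ with i , _ , refl ← ∈-map⁻ (petal k) e∈ | j , _ , refl ← ∈-map⁻ (petal k) f∈ =
    bound≤∣petal∩petal∣ k i j

-- No term exceeds its `bound`, yet comparison with a star of the same size shows that the sum of
-- all terms reaches the sum of all bounds. Hence every single term is tight.
maximiser⇒∣∩∣≥ : (H : RGraph (suc k)) → MaximisesP₂ H → e ∈ edges H → f ∈ edges H →
                 k ≤ length (e ∩ f)
maximiser⇒∣∩∣≥ {k} H H-max e∈H f∈H =
  -- The nested use of `∑-mono-≤-tight` makes the row of `e` tight, the enclosing one the entry at
  -- `f`; `m≤m+n` discards the diagonal bracket.
  ≤-trans (m≤m+n k _) (∑-mono-≤-tight E (upper e∈H) (∑-mono-≤-tight E (λ e∈H → ∑-mono-≤ E (upper e∈H)) total e∈H) f∈H)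
  where
  E = edges H

  upper : e ∈ E → f ∈ E → length (e ∩ f) ≤ bound k e f
  upper e∈H f∈H = ∣∩∣≤bound (rset H e∈H) (rset H f∈H)

  total : ∑ E (λ e → ∑ E (bound k e)) ≤ ∑ E (λ e → ∑ E λ f → length (e ∩ f))
  total = begin
    ∑ E (λ e → ∑ E (bound k e))            ≡⟨ ∑-bound k H ⟩
    ∣ H ∣ * (∣ H ∣ * k + 1)                ≤⟨ P₂-star k ∣ H ∣ ⟩
    P₂ (star k ∣ H ∣)                      ≤⟨ H-max (star k ∣ H ∣) (∣star∣ k ∣ H ∣) ⟩
    P₂ H                                   ≡⟨ P₂≡∑∣∩∣ H ⟩
    ∑ E (λ e → ∑ E λ f → length (e ∩ f))   ∎
    where open ≤-Reasoning

-- Relabelling into an initial segment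

module Relabelling (H : RGraph r) (φ : ℕ → ℕ)
  (φ-bounded : ∀ {x} → x ∈ vertices H → [ n ] (φ x))
  (φ-injective : ∀ {x y} → x ∈ vertices H → y ∈ vertices H → φ x ≡ φ y → x ≡ y) where

  -- `map φ e` need not be increasing. Filtering the increasing list `interval n` by membership in
  -- it produces the sorted representative.
  image : VertexSet → VertexSet
  image e = interval n ∩ map φ e

  image-set : e ∈ edges H → map φ e ∼[ set ] image e
  image-set e∈H = mk⇔ to (proj₂ ∘ ∈-∩⁻ {e = interval n})
    where
    to : map φ _ ⊆ image _
    to z∈ with x , x∈e , refl ← ∈-map⁻ φ z∈ =
      ∈-∩⁺ (∈-interval⁺ (φ-bounded (⊆vertices H e∈H x∈e))) z∈

  image-ascending : ∀ e → AllPairs _<_ (image e)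
  image-ascending e = AllPairs.filter⁺ _ (interval-ascending n)

  image-⊆ : ∀ e → All [ n ] (image e)
  image-⊆ e = All.tabulate (∈-interval⁻ ∘ proj₁ ∘ ∈-∩⁻ {e = interval n})

  ∣image∣ : e ∈ edges H → length (image e) ≡ r
  ∣image∣ {e} e∈H with _ , _ , ∣e∣ ← rset H e∈H =
    trans (↭-length (↭-sym image↭)) (trans (length-map φ e) ∣e∣)
    where
    image↭ : map φ e ↭ image e
    image↭ = Unique⇒↭
      (Unique-map⁺ φ (λ x∈ y∈ → φ-injective (⊆vertices H e∈H x∈) (⊆vertices H e∈H y∈))
        (Unique-rset (rset H e∈H)))
      (ascending⇒Unique (image-ascending e)) (image-set e∈H)

  -- The label `φ x` of a vertex of `e` also occurs as `φ y` with `y ∈ f`, and `φ` separates the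
  -- vertices of `H`.
  image-reflects-⊆ : e ∈ edges H → f ∈ edges H → image e ≡ image f → e ⊆ f
  image-reflects-⊆ {e} {f} e∈H f∈H eq x∈e
    with y , y∈f , φx≡φy ← ∈-map⁻ φ (Equivalence.from (image-set f∈H)
           (subst (_ ∈_) eq (Equivalence.to (image-set e∈H) (∈-map⁺ φ x∈e)))) =
    subst (_∈ f) (sym (φ-injective (⊆vertices H e∈H x∈e) (⊆vertices H f∈H y∈f) φx≡φy)) y∈f

  image-injective : e ∈ edges H → f ∈ edges H → image e ≡ image f → e ≡ f
  image-injective e∈H f∈H eq = ascending-↭⇒≡ (proj₁ (rset H e∈H)) (proj₁ (rset H f∈H))
    (Unique⇒↭ (Unique-rset (rset H e∈H)) (Unique-rset (rset H f∈H))
      (mk⇔ (image-reflects-⊆ e∈H f∈H eq) (image-reflects-⊆ f∈H e∈H (sym eq))))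

  K : RGraph r
  K = record
    { edges  = map image (edges H)
    ; unique = Unique-map⁺ image image-injective (unique H)
    ; rsets  = All.map⁺ (All.tabulate λ {e} e∈H →
        image-ascending e , All.map proj₁ (image-⊆ e) , ∣image∣ e∈H)
    }

  K⊆ : K ⊆ᴱ [ n ] ⁽ r ⁾
  K⊆ = All.map⁺ (All.tabulate λ {e} e∈H → image-ascending e , image-⊆ e , ∣image∣ e∈H)

  H≅K : H ≅ K
  H≅K = record
    { relabel   = φ
    ; injective = φ-injective
    ; into      = λ {e} e∈H → image e , ∈-map⁺ image e∈H , image-set e∈H
    ; onto      = onto
    }
    where
    onto : e ∈ map image (edges H) → ∃[ e′ ] e′ ∈ edges H × map φ e′ ∼[ set ] e
    onto e∈K with e′ , e′∈H , refl ← ∈-map⁻ image e∈K = e′ , e′∈H , image-set e′∈H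

-- Positions are counted from 1; the value 0 off U is junk.
position : List ℕ → ℕ → ℕ
position U x with _∈?_ _≟_ x U
... | yes x∈U = suc (toℕ (index x∈U))
... | no  _   = 0

position-bounded : ∀ U → x ∈ U → [ length U ] (position U x)
position-bounded {x} U x∈U with _∈?_ _≟_ x U
... | yes p   = s≤s z≤n , toℕ<n (index p)
... | no  x∉U = contradiction x∈U x∉U

-- Equal indices point to the same entry of `U`.
position-injective : ∀ U → x ∈ U → y ∈ U → position U x ≡ position U y → x ≡ y
position-injective {x} {y} U x∈U y∈U eq with _∈?_ _≟_ x U | _∈?_ _≟_ y U
... | yes p   | yes q   = index-injective (setoid ℕ) p q (toℕ-injective (suc-injective eq))
... | no  x∉U | _       = contradiction x∈U x∉U
... | yes _   | no  y∉U = contradiction y∈U y∉U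

-- Vertices are relabelled by their position in `U`. Each non-isolated vertex lies in some edge and
-- so in `U`, where positions are bounded and injective.
⊆⇒≅subclique : (H : RGraph r) (U : List ℕ) → length U ≡ n → All (_⊆ U) (edges H) →
               ∃[ K ] K ⊆ᴱ [ n ] ⁽ r ⁾ × H ≅ K
⊆⇒≅subclique H U refl H⊆U = K , K⊆ , H≅K
  where
  vertices⊆U : vertices H ⊆ U
  vertices⊆U x∈V with e , x∈e , e∈H ← ∈-concat⁻′ (edges H) (∈-deduplicate⁻ _≟_ _ x∈V) =
    All.lookup H⊆U e∈H x∈e

  open Relabelling H (position U) (position-bounded U ∘ vertices⊆U)
    (λ x∈V y∈V → position-injective U (vertices⊆U x∈V) (vertices⊆U y∈V))

-- Families of sets that pairwise differ in one element

module _ (H : RGraph (suc k))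
  (∣∩∣≥ : ∀ {e f} → e ∈ edges H → f ∈ edges H → k ≤ length (e ∩ f)) where

  private
    E = edges H

  ∖-unique : e ∈ E → f ∈ E → x ∈ e → x ∉ f → y ∈ e → y ∉ f → x ≡ y
  ∖-unique e∈H f∈H = difference-unique (rset H e∈H) (∣∩∣≥ e∈H f∈H)

  subclique⊎kernel : e ∈ E → f ∈ E → e ≢ f →
    (∃[ K ] K ⊆ᴱ [ suc k + 1 ] ⁽ suc k ⁾ × H ≅ K)
    ⊎ (∃[ S ] (ℕ₊ ⁽ k ⁾) S × All (S ⊆_) E)
  subclique⊎kernel {e} {f} e∈H f∈H e≢f
    with a , a∈e , a∉f ← difference-inhabited (rset H e∈H) (rset H f∈H) e≢f
       | b , b∈f , b∉e ← difference-inhabited (rset H f∈H) (rset H e∈H) (e≢f ∘ sym)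
       | All.all? (All.all? (λ x → _∈?_ _≟_ x (b ∷ e))) E
  -- The vertex `b` joins the `suc k` vertices of `e`, which gives the `suc k + 1` vertices of the
  -- clique.
  ... | yes H⊆U = inj₁ (⊆⇒≅subclique H (b ∷ e)
          (trans (cong suc (proj₂ (proj₂ (rset H e∈H)))) (+-comm 1 (suc k)))
          (All.map All.lookup H⊆U))
  ... | no  H⊈U
    with g , g∈H , g⊈U ← find (All.¬All⇒Any¬ (All.all? (λ x → _∈?_ _≟_ x (b ∷ e))) E H⊈U)
    with y , y∈g , y∉U ← find (All.¬All⇒Any¬ (λ x → _∈?_ _≟_ x (b ∷ e)) g g⊈U) =
      inj₂ (e ∩ f , kernel , All.tabulate kernel⊆)
    where
    f⊆U : f ⊆ b ∷ e
    f⊆U {x} x∈f with _∈?_ _≟_ x e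
    ... | yes x∈e = there x∈e
    ... | no  x∉e = here (∖-unique f∈H e∈H x∈f x∉e b∈f b∉e)

    -- If s ∉ g then b ∈ g, because s, b ∈ f; but g ∖ e = {y} and b ≠ y.
    leaving⇒∋ : ∀ {g y s} → g ∈ E → y ∈ g → y ∉ b ∷ e → s ∈ e → s ∈ f → s ∈ g
    leaving⇒∋ {g} {y} {s} g∈H y∈g y∉U s∈e s∈f with _∈?_ _≟_ s g | _∈?_ _≟_ b g
    ... | yes s∈g | _       = s∈g
    ... | no  _   | yes b∈g = contradiction (here (∖-unique g∈H e∈H y∈g (y∉U ∘ there) b∈g b∉e)) y∉U
    ... | no  s∉g | no  b∉g = contradiction (subst (_∈ e) (∖-unique f∈H g∈H s∈f s∉g b∈f b∉g) s∈e) b∉e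

    kernel : (ℕ₊ ⁽ k ⁾) (e ∩ f)
    kernel = AllPairs.filter⁺ _ (proj₁ (rset H e∈H))
           , All.filter⁺ _ (proj₁ (proj₂ (rset H e∈H)))
           , ≤-antisym (∣∩∣≤ (rset H e∈H) (rset H f∈H) e≢f) (∣∩∣≥ e∈H f∈H)

    -- For `s ∉ h` it suffices to ask whether `y`, where `g` leaves `b ∷ e`, lies in `h`. If so, `h`
    -- leaves there too and `leaving⇒∋` gives `s ∈ h`. If not, `s` and `y` both lie in `g` and
    -- outside `h`, so they coincide, although `s ∈ e` and `y ∉ b ∷ e`.
    kernel⊆ : h ∈ E → e ∩ f ⊆ h
    kernel⊆ {h} h∈H {s} s∈S with s∈e , s∈f ← ∈-∩⁻ {e = e} s∈S | _∈?_ _≟_ s h | _∈?_ _≟_ y h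
    ... | yes s∈h | _       = s∈h
    ... | no  s∉h | yes y∈h = leaving⇒∋ h∈H y∈h y∉U s∈e s∈f
    ... | no  s∉h | no  y∉h = contradiction
      (there (subst (_∈ e) (∖-unique g∈H h∈H (leaving⇒∋ g∈H y∈g y∉U s∈e s∈f) s∉h y∈g y∉h) s∈e)) y∉U

proposition1p5 : ∀ (r : ℕ) → 1 ≤ r → (H : RGraph r) → MaximisesP₂ H →
    (∃[ K ] K ⊆ᴱ [ r + 1 ] ⁽ r ⁾ × H ≅ K)
    ⊎ (∃[ S ] (ℕ₊ ⁽ r ∸ 1 ⁾) S × All (S ⊆_) (edges H))
-- Without edges any `k`-set serves vacuously.
proposition1p5 (suc k) _ H@record { edges = [] } H-max =
  inj₂ (interval k , (interval-ascending k , All.tabulate (proj₁ ∘ ∈-interval⁻) , length-applyUpTo suc k) , [])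
proposition1p5 (suc k) _ record { edges = [] ∷ [] ; rsets = (_ , _ , ()) ∷ [] } H-max
-- A single edge contains the `k`-set left after removing its least vertex.
proposition1p5 (suc k) _ record { edges = (x ∷ S) ∷ [] ; rsets = (_ ∷ S↗ , _ ∷ S₊ , ∣S∣) ∷ [] } H-max =
  inj₂ (S , (S↗ , S₊ , suc-injective ∣S∣) , there ∷ [])
proposition1p5 (suc k) _ H@record { edges = e ∷ f ∷ _ ; unique = (e≢f ∷ _) ∷ _ } H-max =
  subclique⊎kernel H (maximiser⇒∣∩∣≥ H H-max) (here refl) (there (here refl)) e≢f
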